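{- Fix a constant $c>1$. In the semi-oblivious cup game with multiplicative error factor $c$ on $n$ cups, the greedy algorithm achieves backlog $O\!\left(n^{\frac{c-1}{c}}\right)$; that is, there is a constant $C=C(c)$ such that for every $n\ge 1$, against every adversary strategy (including every choice of estimates), the backlog is at most $C\,n^{(c-1)/c}$.
   Context: Semi-oblivious cup game (multiplicative error factor $c>1$). There are $n$ cups, initially empty; heights are nonnegative reals. Time proceeds in discrete steps. In each step the adversary first distributes $1$ unit of water among the cups arbitrarily (nonnegative amounts summing to $1$), resulting in intermediate heights $g_1(t),\dots,g_n(t)$. The adversary then shows the player estimates $g_i'(t)\in[g_i(t),\,c\,g_i(t)]$ for each cup $i$, of the adversary's choice. The player then selects one cup and removes up to $1$ unit of water from it: if cup $i$ is selected, its height becomes $\max(g_i(t)-1,0)$, and all other heights are unchanged. The adversary may be adaptive. Greedy algorithm: the player always selects a cup $i$ with maximal estimate $g_i'(t)$, ties broken arbitrarily (the worst case includes worst-case tie-breaking). Backlog: the supremum over all time steps (including the intermediate moment after the adversary's move) of the height of the fullest cup. -}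

module Defs where

open import Algebra.Bundles using (CommutativeRing; Semiring)
open import Algebra.Core using (Op₁; Op₂)
open import Algebra.Structures using (IsCommutativeRing)
import Algebra.Construct.NaturalChoice.Max as NaturalMax
import Algebra.Definitions.RawSemiring as RawSemiringDefs
import Algebra.Properties.Ring as RingProperties
import Algebra.Properties.Semiring.Exp as ExpProperties
import Algebra.Properties.Semiring.Mult as SemiringMultProperties
open import Data.Empty using (⊥-elim)
open import Data.Fin.Base using (Fin)
open import Data.Nat.Base as ℕ using (ℕ; zero; suc; NonZero; z≤n; s≤s)
import Data.Nat.Properties as ℕ
open import Data.Product using (Σ; ∃; ∃₂; _,_; proj₁; proj₂; _×_)
open import Data.Sum.Base using (inj₁; inj₂)
open import Data.Vec.Functional using (Vector; updateAt)
open import Level using (0ℓ)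
open import Relation.Binary.Bundles using (DecTotalOrder)
import Relation.Binary.Construct.NonStrictToStrict as ToStrict
open import Relation.Binary.Core using (Rel)
import Relation.Binary.PropositionalEquality.Core as ≡
import Relation.Binary.Reasoning.Setoid as SetoidReasoning
open import Relation.Binary.Structures using (IsDecTotalOrder)
open import Relation.Nullary using (¬_; yes; no)

------------------------------------------------------------------------
-- The real numbers

-- The classical axioms of ℝ, which determine it up to isomorphism.  The
-- decidable order and the least upper bound axiom for arbitrary
-- predicates are not constructively valid, so a statement about the
-- reals takes an arbitrary such structure as a hypothesis.

record CompleteOrderedField : Set₁ where
  infix  9 _⁻¹
  infix  8 -_
  infixl 7 _*_
  infixl 6 _+_
  infix  4 _≈_ _≤_
  field
    Carrier           : Set
    _≈_               : Rel Carrier 0ℓ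
    _≤_               : Rel Carrier 0ℓ
    _+_               : Op₂ Carrier
    _*_               : Op₂ Carrier
    -_                : Op₁ Carrier
    0#                : Carrier
    1#                : Carrier
    _⁻¹               : Op₁ Carrier
    isCommutativeRing : IsCommutativeRing _≈_ _+_ _*_ -_ 0# 1#
    isDecTotalOrder   : IsDecTotalOrder _≈_ _≤_
    0≉1               : ¬ 0# ≈ 1#
    -- The value of 0# ⁻¹ is unspecified.
    ⁻¹-inverseʳ       : ∀ {x} → ¬ x ≈ 0# → x * x ⁻¹ ≈ 1#
    +-monoʳ-≤         : ∀ z {x y} → x ≤ y → z + x ≤ z + y
    *-nonneg          : ∀ {x y} → 0# ≤ x → 0# ≤ y → 0# ≤ x * y

  UpperBound : (Carrier → Set) → Carrier → Set
  UpperBound P u = ∀ x → P x → x ≤ u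

  IsSupremum : (Carrier → Set) → Carrier → Set
  IsSupremum P s = UpperBound P s × (∀ u → UpperBound P u → s ≤ u)

  field
    supremum : (P : Carrier → Set) → ∃ P → ∃ (UpperBound P) → ∃ (IsSupremum P)

  commutativeRing : CommutativeRing 0ℓ 0ℓ
  commutativeRing = record { isCommutativeRing = isCommutativeRing }

  open CommutativeRing commutativeRing public
    using (_-_; setoid; ring; semiring; +-cong; +-congˡ; +-congʳ;
           +-comm; +-assoc; +-identityˡ; +-identityʳ; -‿cong; -‿inverseˡ; -‿inverseʳ;
           *-cong; *-congˡ; *-congʳ; *-comm; *-assoc; *-identityˡ; *-identityʳ;
           distribˡ; distribʳ; zeroˡ; zeroʳ)
  open RawSemiringDefs (Semiring.rawSemiring semiring) public using (sum; _^_) renaming (_×_ to _·_)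

  fromℕ : ℕ → Carrier
  fromℕ n = n · 1#

  field
    -- Follows classically from `supremum`; producing n needs it as an axiom.
    archimedean : ∀ x → ∃ λ n → x ≤ fromℕ n

  decTotalOrder : DecTotalOrder 0ℓ 0ℓ 0ℓ
  decTotalOrder = record { isDecTotalOrder = isDecTotalOrder }

  open DecTotalOrder decTotalOrder public
    using (_≤?_; totalOrder; module Eq)
    renaming (total to ≤-total; trans to ≤-trans; refl to ≤-refl; reflexive to ≤-reflexive;
              antisym to ≤-antisym)

  open ToStrict _≈_ _≤_ public using (_<_)
  open NaturalMax totalOrder public using (_⊔_)

------------------------------------------------------------------------
-- Order properties

module OrderProperties (ℝ : CompleteOrderedField) where
  open CompleteOrderedField ℝ
  open RingProperties ring using (-‿distribˡ-*; -‿distribʳ-*; -‿involutive; [y-z]x≈yx-zx)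
  open SetoidReasoning setoid

  ≤-resp : ∀ {x x′ y y′} → x ≈ x′ → y ≈ y′ → x ≤ y → x′ ≤ y′
  ≤-resp p q r = ≤-trans (≤-reflexive (Eq.sym p)) (≤-trans r (≤-reflexive q))

  x≤y⇒0≤y-x : ∀ {x y} → x ≤ y → 0# ≤ y - x
  x≤y⇒0≤y-x {x} {y} x≤y =
    ≤-resp (-‿inverseˡ x) (+-comm (- x) y) (+-monoʳ-≤ (- x) x≤y)

  x+[y-x]≈y : ∀ x y → x + (y - x) ≈ y
  x+[y-x]≈y x y = begin
    x + (y - x)   ≈⟨ +-congˡ (+-comm y (- x)) ⟩
    x + (- x + y) ≈⟨ +-assoc x (- x) y ⟨
    x - x + y     ≈⟨ +-congʳ (-‿inverseʳ x) ⟩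
    0# + y        ≈⟨ +-identityˡ y ⟩
    y             ∎

  0≤y-x⇒x≤y : ∀ {x y} → 0# ≤ y - x → x ≤ y
  0≤y-x⇒x≤y {x} {y} 0≤y-x =
    ≤-resp (+-identityʳ x) (x+[y-x]≈y x y) (+-monoʳ-≤ x 0≤y-x)

  0≤1 : 0# ≤ 1#
  0≤1 with ≤-total 0# 1#
  ... | inj₁ 0≤1 = 0≤1
  ... | inj₂ 1≤0 = ≤-resp Eq.refl eq (*-nonneg 0≤-1 0≤-1)
    where
    0≤-1 : 0# ≤ - 1#
    0≤-1 = ≤-resp Eq.refl (+-identityˡ (- 1#)) (x≤y⇒0≤y-x 1≤0)
    eq : - 1# * - 1# ≈ 1#
    eq = begin
      - 1# * - 1#     ≈⟨ -‿distribˡ-* 1# (- 1#) ⟨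
      - (1# * - 1#)   ≈⟨ -‿cong (*-identityˡ (- 1#)) ⟩
      - - 1#          ≈⟨ -‿involutive 1# ⟩
      1#              ∎

  *-monoʳ-≤ : ∀ {x y z} → 0# ≤ z → x ≤ y → x * z ≤ y * z
  *-monoʳ-≤ {x} {y} {z} 0≤z x≤y =
    0≤y-x⇒x≤y (≤-resp Eq.refl ([y-z]x≈yx-zx z y x) (*-nonneg (x≤y⇒0≤y-x x≤y) 0≤z))

  *-monoˡ-≤ : ∀ {x y z} → 0# ≤ z → x ≤ y → z * x ≤ z * y
  *-monoˡ-≤ {x} {y} {z} 0≤z x≤y = ≤-resp (*-comm x z) (*-comm y z) (*-monoʳ-≤ 0≤z x≤y)

  1≰0 : ¬ 1# ≤ 0#
  1≰0 1≤0 = 0≉1 (≤-antisym 0≤1 1≤0)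

  1+x≰x : ∀ x → ¬ 1# + x ≤ x
  1+x≰x x 1+x≤x = 1≰0 (≤-resp eq (-‿inverseˡ x) (+-monoʳ-≤ (- x) 1+x≤x))
    where
    eq : - x + (1# + x) ≈ 1#
    eq = begin
      - x + (1# + x) ≈⟨ +-comm _ _ ⟩
      1# + x - x     ≈⟨ +-assoc _ _ _ ⟩
      1# + (x - x)   ≈⟨ +-congˡ (-‿inverseʳ x) ⟩
      1# + 0#        ≈⟨ +-identityʳ 1# ⟩
      1#             ∎

  0≤fromℕ : ∀ n → 0# ≤ fromℕ n
  0≤fromℕ zero    = ≤-refl
  0≤fromℕ (suc n) = ≤-trans 0≤1 (≤-resp (+-identityʳ 1#) Eq.refl (+-monoʳ-≤ 1# (0≤fromℕ n)))

  fromℕ-mono-≤ : ∀ {m n} → m ℕ.≤ n → fromℕ m ≤ fromℕ n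
  fromℕ-mono-≤ {n = n} z≤n = 0≤fromℕ n
  fromℕ-mono-≤ (s≤s m≤n)   = +-monoʳ-≤ 1# (fromℕ-mono-≤ m≤n)

  1≤fromℕ : ∀ {n} → 1 ℕ.≤ n → 1# ≤ fromℕ n
  1≤fromℕ 1≤n = ≤-resp (+-identityʳ 1#) Eq.refl (fromℕ-mono-≤ 1≤n)

  fromℕ-cancel-≤ : ∀ {m n} → fromℕ m ≤ fromℕ n → m ℕ.≤ n
  fromℕ-cancel-≤ {m} {n} p with m ℕ.≤? n
  ... | yes m≤n = m≤n
  ... | no  m≰n = ⊥-elim (1+x≰x (fromℕ n) (≤-trans (fromℕ-mono-≤ (ℕ.≰⇒> m≰n)) p))

  ^-nonneg : ∀ {x} n → 0# ≤ x → 0# ≤ x ^ n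
  ^-nonneg zero    0≤x = 0≤1
  ^-nonneg (suc n) 0≤x = *-nonneg 0≤x (^-nonneg n 0≤x)

  1≤^ : ∀ {x} n → 1# ≤ x → 1# ≤ x ^ n
  1≤^ zero    1≤x = ≤-refl
  1≤^ (suc n) 1≤x = ≤-trans 1≤x
    (≤-resp (*-identityʳ _) Eq.refl (*-monoˡ-≤ (≤-trans 0≤1 1≤x) (1≤^ n 1≤x)))

  ^-monoʳ-≤ : ∀ {x m n} → 1# ≤ x → m ℕ.≤ n → x ^ m ≤ x ^ n
  ^-monoʳ-≤ {n = n} 1≤x z≤n = 1≤^ n 1≤x
  ^-monoʳ-≤ 1≤x (s≤s m≤n)   = *-monoˡ-≤ (≤-trans 0≤1 1≤x) (^-monoʳ-≤ 1≤x m≤n)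

  ^-monoˡ-≤ : ∀ {x y} n → 0# ≤ x → x ≤ y → x ^ n ≤ y ^ n
  ^-monoˡ-≤ zero    0≤x x≤y = ≤-refl
  ^-monoˡ-≤ (suc n) 0≤x x≤y = ≤-trans
    (*-monoʳ-≤ (^-nonneg n 0≤x) x≤y)
    (*-monoˡ-≤ (≤-trans 0≤x x≤y) (^-monoˡ-≤ n 0≤x x≤y))

  *-cancelʳ-≤ : ∀ {x y z} → 0# ≤ z → ¬ z ≈ 0# → x * z ≤ y * z → x ≤ y
  *-cancelʳ-≤ {x} {y} {z} 0≤z z≉0 xz≤yz = ≤-resp (eq x) (eq y) (*-monoʳ-≤ (0≤z⁻¹) xz≤yz)
    where
    0≤z⁻¹ : 0# ≤ z ⁻¹
    0≤z⁻¹ with ≤-total 0# (z ⁻¹)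
    ... | inj₁ p = p
    ... | inj₂ p = ⊥-elim (1≰0 (≤-resp (⁻¹-inverseʳ z≉0) (zeroʳ z) (*-monoˡ-≤ 0≤z p)))
    eq : ∀ w → w * z * z ⁻¹ ≈ w
    eq w = Eq.trans (*-assoc w z (z ⁻¹))
      (Eq.trans (*-congˡ (⁻¹-inverseʳ z≉0)) (*-identityʳ w))

  0≤⁻¹ : ∀ {z} → 0# ≤ z → ¬ z ≈ 0# → 0# ≤ z ⁻¹
  0≤⁻¹ {z} 0≤z z≉0 = *-cancelʳ-≤ 0≤z z≉0
    (≤-resp (Eq.sym (zeroˡ z)) (Eq.sym (Eq.trans (*-comm _ _) (⁻¹-inverseʳ z≉0))) 0≤1)

  ^-cancelˡ-≤ : ∀ {x y} n → 1# ≤ y → x ^ suc n ≤ y ^ suc n → x ≤ y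
  ^-cancelˡ-≤ {x} {y} n 1≤y xⁿ≤yⁿ with x ≤? y
  ... | yes x≤y = x≤y
  ... | no  x≰y with ≤-total x y
  ...   | inj₁ x≤y = x≤y
  ...   | inj₂ y≤x = *-cancelʳ-≤ (≤-trans 0≤1 1≤yⁿ) yⁿ≉0
                       (≤-trans (*-monoˡ-≤ (≤-trans 0≤y y≤x) (^-monoˡ-≤ n 0≤y y≤x)) xⁿ≤yⁿ)
    where
    0≤y : 0# ≤ y
    0≤y = ≤-trans 0≤1 1≤y
    1≤yⁿ : 1# ≤ y ^ n
    1≤yⁿ = 1≤^ n 1≤y
    yⁿ≉0 : ¬ y ^ n ≈ 0#
    yⁿ≉0 eq = 1≰0 (≤-resp Eq.refl eq 1≤yⁿ)

------------------------------------------------------------------------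
-- Powers with real exponents

module RealPower (ℝ : CompleteOrderedField) where
  open CompleteOrderedField ℝ
  open OrderProperties ℝ
  open SemiringMultProperties semiring using (×1-homo-*)
  open ExpProperties semiring using (^-assocʳ)

  -- y = b ^ (p / q) for some rational p / q with 0 ≤ p / q ≤ x.
  RationalPowerBelow : Carrier → Carrier → Carrier → Set
  RationalPowerBelow b x y =
    ∃₂ λ p q → NonZero q × fromℕ p ≤ fromℕ q * x × 0# ≤ y × y ^ q ≈ b ^ p

  module _ {b x : Carrier} (1≤b : 1# ≤ b) (0≤x : 0# ≤ x) where

    rationalPower : ∃ (RationalPowerBelow b x)
    rationalPower = 1# , 0 , 1 , _ , *-nonneg (0≤fromℕ 1) 0≤x , 0≤1 , *-identityʳ 1#

    rationalPowers-bounded : ∃ (UpperBound (RationalPowerBelow b x))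
    rationalPowers-bounded with archimedean x
    ... | N , x≤N = b ^ N , bound
      where
      bound : UpperBound (RationalPowerBelow b x) (b ^ N)
      bound y (p , suc q , _ , p≤qx , 0≤y , y^q≈b^p) =
        ^-cancelˡ-≤ q (1≤^ N 1≤b)
          (≤-resp (Eq.sym y^q≈b^p) (Eq.sym (^-assocʳ b N (suc q))) (^-monoʳ-≤ 1≤b p≤Nq))
        where
        p≤Nq : p ℕ.≤ N ℕ.* suc q
        p≤Nq = ≡.subst (p ℕ.≤_) (ℕ.*-comm (suc q) N)
          (fromℕ-cancel-≤ (≤-resp Eq.refl (Eq.sym (×1-homo-* (suc q) N))
            (≤-trans p≤qx (*-monoˡ-≤ (0≤fromℕ (suc q)) x≤N))))

  -- b ^ x = sup { b ^ r : r rational, r ≤ x }, for b ≥ 1 and x ≥ 0.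
  power : (b x : Carrier) → 1# ≤ b → 0# ≤ x → Carrier
  power b x 1≤b 0≤x =
    proj₁ (supremum (RationalPowerBelow b x) (rationalPower 1≤b 0≤x)
                    (rationalPowers-bounded 1≤b 0≤x))

  0≤exponent : ∀ {c} → 1# < c → 0# ≤ (c - 1#) * c ⁻¹
  0≤exponent (1≤c , _) = *-nonneg (x≤y⇒0≤y-x 1≤c) (0≤⁻¹ (≤-trans 0≤1 1≤c) c≉0)
    where
    c≉0 : ¬ _ ≈ 0#
    c≉0 eq = 1≰0 (≤-resp Eq.refl eq 1≤c)

------------------------------------------------------------------------
-- The semi-oblivious cup game on n cups with error factor c

module CupGame (ℝ : CompleteOrderedField) (c : CompleteOrderedField.Carrier ℝ) (n : ℕ) where
  open CompleteOrderedField ℝ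

  Heights : Set
  Heights = Vector Carrier n

  record Move (h : Heights) : Set where
    field
      pour        : Vector Carrier n
      pour-nonneg : ∀ i → 0# ≤ pour i
      pour-total  : sum pour ≈ 1#

    filled : Heights
    filled i = h i + pour i

    field
      estimate       : Vector Carrier n
      estimate-lower : ∀ i → filled i ≤ estimate i
      estimate-upper : ∀ i → estimate i ≤ c * filled i

  open Move public

  remove : Fin n → Heights → Heights
  remove i g = updateAt g i (λ x → (x - 1#) ⊔ 0#)

  data History : Heights → Set where
    start : History (λ _ → 0#)
    step  : ∀ {h} → History h → (move : Move h) (i : Fin n) →
            History (remove i (filled move))

  Adversary : Set
  Adversary = ∀ {h} → History h → Move h

  Player : Set
  Player = ∀ {h} → History h → Move h → Fin n

  -- Ties may be broken in any way, even using information (such as the true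
  -- heights) that is hidden from the player.
  Greedy : Player → Set
  Greedy player = ∀ {h} (past : History h) (move : Move h) (j : Fin n) →
                  estimate move j ≤ estimate move (player past move)

  IsFullest : Heights → Carrier → Set
  IsFullest g x = (∃ λ i → g i ≈ x) × (∀ j → g j ≤ x)

  module _ (adversary : Adversary) (player : Player) where

    run : ℕ → ∃ History
    run zero    = _ , start
    run (suc t) = _ , step past (adversary past) (player past (adversary past))
      where past = proj₂ (run t)

    data Visited : Heights → Set where
      between      : ∀ t → Visited (proj₁ (run t))
      intermediate : ∀ t → Visited (filled (adversary (proj₂ (run t))))

    IsBacklog : Carrier → Set
    IsBacklog = IsSupremum (λ x → ∃ λ g → Visited g × IsFullest g x)

{-# OPTIONS --safe #-}
module Submission where

-- Greedy empties a cup i with g_j ≤ c g_i for every cup j.  Fix a set A of k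
-- cups with total X before the removal.  If i ∈ A and g_i ≥ 1, the removal
-- undoes the pouring; if g_i ≤ 1, all heights are at most c; if i ∉ A, then
-- X ≤ c k g_i, so A together with i already held X (1 + 1 / (c k)) - 1 before
-- the move.  In terms of the shifted total Y_k = X + k c / (c - 1), bounded by
-- k b_k over all sets of size k, the last case asks for
--
--   b_k (k + 1 / c) ≥ (k + 1) b_{k+1},
--
-- which b_k proportional to k ^ -(1 - 1 / c) would satisfy by Bernoulli's
-- inequality.  To stay with rational exponents, put q = 2 n, let p / q be the
-- largest such fraction below 1 - 1 / c and take b_k proportional to
-- (2 n - k) / k ^ (p / q) instead: the factor 2 n - k absorbs the rounding at
-- the price of a factor 2, and n ^ (p / q) is one of the rational powers whose
-- supremum is n ^ (1 - 1 / c).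

open import Defs
open import Algebra.Bundles using (CommutativeRing)
import Algebra.Construct.NaturalChoice.MaxOp as MaxOpProperties
import Algebra.Construct.NaturalChoice.Max as NaturalMax
import Algebra.Properties.Semiring.Exp as ExpProperties
import Algebra.Properties.Semiring.Mult as SemiringMultProperties
import Algebra.Solver.Ring.NaturalCoefficients.Default as NaturalCoefficientsSolver
open import Data.Fin.Base using (Fin; zero; suc)
open import Data.Fin.Properties using (_≟_)
open import Data.Fin.Subset using (Subset; inside; outside; ∣_∣; ⊥)
open import Data.Fin.Subset.Properties using (∣p∣≤n; ∣⊥∣≡0)
open import Data.Nat.Base as ℕ using (ℕ; zero; suc; z≤n; s≤s)
import Data.Nat.Properties as ℕ
open import Data.Product using (∃; _,_; proj₁; proj₂; _×_)
open import Data.Sum.Base using (inj₁; inj₂)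
open import Data.Vec.Base using ([]; _∷_; lookup; _[_]≔_)
open import Data.Vec.Properties using (lookup-replicate)
open import Data.Vec.Functional using (Vector; updateAt; tail)
open import Data.Vec.Functional.Properties using (updateAt-updates; updateAt-minimal)
open import Relation.Binary.PropositionalEquality.Core as ≡ using (_≡_)
open import Relation.Nullary using (¬_; yes; no)

-- Ordered field arithmetic

module OrderedFieldProperties (ℝ : CompleteOrderedField) where
  open CompleteOrderedField ℝ
  open OrderProperties ℝ
  open NaturalCoefficientsSolver
    (CommutativeRing.commutativeSemiring commutativeRing) public

  +-mono-≤ : ∀ {x y z w} → x ≤ y → z ≤ w → x + z ≤ y + w
  +-mono-≤ {x} {y} {z} {w} x≤y z≤w = ≤-trans
    (≤-resp (+-comm z x) (+-comm z y) (+-monoʳ-≤ z x≤y)) (+-monoʳ-≤ y z≤w)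

  +-cancelʳ-≤ : ∀ z {x y} → x + z ≤ y + z → x ≤ y
  +-cancelʳ-≤ z {x} {y} p = ≤-resp (eq x) (eq y) (+-mono-≤ p ≤-refl)
    where
    eq : ∀ w → w + z - z ≈ w
    eq w = Eq.trans (+-assoc w z (- z))
      (Eq.trans (+-congˡ (-‿inverseʳ z)) (+-identityʳ w))

  -- x ≤ y whenever y - x ≈ r - l, with the terms moved so that no subtraction
  -- occurs and the semiring solver applies.
  ≤-by : ∀ {x y l r} → l ≤ r → x + r ≈ y + l → x ≤ y
  ≤-by {x} {y} {l} {r} l≤r eq =
    +-cancelʳ-≤ r (≤-trans (≤-reflexive eq) (+-monoʳ-≤ y l≤r))

  x≤x+y : ∀ x {y} → 0# ≤ y → x ≤ x + y
  x≤x+y x 0≤y = ≤-resp (+-identityʳ x) Eq.refl (+-monoʳ-≤ x 0≤y)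

  +-nonneg : ∀ {x y} → 0# ≤ x → 0# ≤ y → 0# ≤ x + y
  +-nonneg {x} 0≤x 0≤y = ≤-trans 0≤x (x≤x+y x 0≤y)

  ≤-subʳ : ∀ {x y z} → x + y ≤ z → x ≤ z - y
  ≤-subʳ {x} {y} {z} x+y≤z = +-cancelʳ-≤ y
    (≤-resp Eq.refl (Eq.sym (Eq.trans (+-comm (z - y) y) (x+[y-x]≈y y z))) x+y≤z)

  ≤-addʳ : ∀ {x y z} → x ≤ z - y → x + y ≤ z
  ≤-addʳ {x} {y} {z} x≤z-y =
    ≤-resp Eq.refl (Eq.trans (+-comm (z - y) y) (x+[y-x]≈y y z)) (+-mono-≤ x≤z-y ≤-refl)

  *-mono-≤ : ∀ {x y z w} → 0# ≤ z → 0# ≤ y → x ≤ y → z ≤ w → x * z ≤ y * w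
  *-mono-≤ 0≤z 0≤y x≤y z≤w = ≤-trans (*-monoʳ-≤ 0≤z x≤y) (*-monoˡ-≤ 0≤y z≤w)

  1≤⇒0≤ : ∀ {x} → 1# ≤ x → 0# ≤ x
  1≤⇒0≤ = ≤-trans 0≤1

  1≤⇒≉0 : ∀ {x} → 1# ≤ x → ¬ x ≈ 0#
  1≤⇒≉0 1≤x x≈0 = 1≰0 (≤-resp Eq.refl x≈0 1≤x)

  1≤* : ∀ {x y} → 1# ≤ x → 1# ≤ y → 1# ≤ x * y
  1≤* {x} {y} 1≤x 1≤y = ≤-trans 1≤x
    (≤-resp (*-identityʳ x) Eq.refl (*-monoˡ-≤ (1≤⇒0≤ 1≤x) 1≤y))

  -- Here 1 ≤ z stands in for positivity: most of the factors cancelled below are known to be at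
  -- least 1.
  *-cancelʳ-1≤ : ∀ {x y z} → 1# ≤ z → x * z ≤ y * z → x ≤ y
  *-cancelʳ-1≤ 1≤z = *-cancelʳ-≤ (1≤⇒0≤ 1≤z) (1≤⇒≉0 1≤z)

  floor : ∀ x → 0# ≤ x → ∃ λ n → fromℕ n ≤ x × x ≤ fromℕ (suc n)
  floor x 0≤x = search (proj₁ (archimedean x)) (proj₂ (archimedean x))
    where
    search : ∀ N → x ≤ fromℕ N → ∃ λ n → fromℕ n ≤ x × x ≤ fromℕ (suc n)
    search zero    x≤0 = 0 , 0≤x , ≤-trans x≤0 (0≤fromℕ 1)
    search (suc N) x≤1+N with ≤-total x (fromℕ N)
    ... | inj₁ x≤N = search N x≤N
    ... | inj₂ N≤x = N , N≤x , x≤1+N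

-- Secant bounds for powers and weighted AM-GM

module Powers (ℝ : CompleteOrderedField) where
  open CompleteOrderedField ℝ
  open OrderProperties ℝ
  open OrderedFieldProperties ℝ
  open ExpProperties semiring using (^-homo-*; ^-congˡ)
  open SemiringMultProperties semiring using (×-homo-+)

  -- The mean value bound y ^ m - x ^ m ≤ m y ^ (m - 1) δ, multiplied by y so that no exponent m - 1
  -- appears.
  ^-secant-upper : ∀ {x δ} m → 0# ≤ x → 0# ≤ δ →
    let y = x + δ in y * y ^ m ≤ y * x ^ m + fromℕ m * (y ^ m * δ)
  ^-secant-upper {x} {δ} zero 0≤x 0≤δ = ≤-reflexive
    (solve 2 (λ x δ → (x :+ δ) :* con 1 := (x :+ δ) :* con 1 :+ con 0 :* (con 1 :* δ)) Eq.refl x δ)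
  ^-secant-upper {x} {δ} (suc m) 0≤x 0≤δ = ≤-by
    (+-mono-≤ (*-monoˡ-≤ 0≤y (^-secant-upper m 0≤x 0≤δ))
              (*-monoˡ-≤ (*-nonneg 0≤y 0≤δ) (^-monoˡ-≤ m 0≤x (x≤x+y x 0≤δ))))
    (solve 5 (λ x δ a b M →
        (x :+ δ) :* ((x :+ δ) :* b)
          :+ ((x :+ δ) :* ((x :+ δ) :* a :+ M :* (b :* δ)) :+ (x :+ δ) :* δ :* b)
      := (x :+ δ) :* (x :* a) :+ (con 1 :+ M) :* ((x :+ δ) :* b :* δ)
          :+ ((x :+ δ) :* ((x :+ δ) :* b) :+ (x :+ δ) :* δ :* a))
      Eq.refl x δ (x ^ m) ((x + δ) ^ m) (fromℕ m))
    where
    0≤y : 0# ≤ x + δ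
    0≤y = +-nonneg 0≤x 0≤δ

  -- The counterpart y ^ m - x ^ m ≥ m x ^ m δ / y, multiplied by y. Having y rather than x in the
  -- denominator makes it match `^-secant-upper` in `weighted-AM-GM`.
  ^-secant-lower : ∀ {x δ} m → 0# ≤ x → 0# ≤ δ →
    let y = x + δ in x ^ m * y + fromℕ m * (x ^ m * δ) ≤ y ^ m * y
  ^-secant-lower {x} {δ} zero 0≤x 0≤δ = ≤-reflexive
    (solve 2 (λ x δ → con 1 :* (x :+ δ) :+ con 0 :* (con 1 :* δ) := con 1 :* (x :+ δ)) Eq.refl x δ)
  ^-secant-lower {x} {δ} (suc m) 0≤x 0≤δ = ≤-by
    (+-mono-≤ (*-monoˡ-≤ 0≤x (^-secant-lower m 0≤x 0≤δ))
              (*-mono-≤ (*-nonneg (^-nonneg m 0≤x) 0≤δ) 0≤y (x≤x+y x 0≤δ)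
                (*-monoʳ-≤ 0≤δ (^-monoˡ-≤ m 0≤x (x≤x+y x 0≤δ)))))
    (solve 5 (λ x δ a b M →
        x :* a :* (x :+ δ) :+ (con 1 :+ M) :* (x :* a :* δ)
          :+ (x :* (b :* (x :+ δ)) :+ (x :+ δ) :* (b :* δ))
      := (x :+ δ) :* b :* (x :+ δ)
          :+ (x :* (a :* (x :+ δ) :+ M :* (a :* δ)) :+ x :* (a :* δ)))
      Eq.refl x δ (x ^ m) ((x + δ) ^ m) (fromℕ m))
    where
    0≤y : 0# ≤ x + δ
    0≤y = +-nonneg 0≤x 0≤δ

  -- Right side minus left side is t y^t (y^p - x^p) - p x^p (y^t - x^t). The lower secant bound for
  -- exponent p and the upper one for t estimate both products by p t x^p y^t δ / y, so they cancel.
  weighted-AM-GM : ∀ {x y} p t → 0# ≤ x → x ≤ y → 1# ≤ y →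
    fromℕ (p ℕ.+ t) * (x ^ p * y ^ t) ≤ fromℕ p * x ^ (p ℕ.+ t) + fromℕ t * y ^ (p ℕ.+ t)
  weighted-AM-GM {x} {y} p t 0≤x x≤y 1≤y =
    ≤-resp (*-congʳ (Eq.sym (×-homo-+ 1# p t)))
           (+-cong (*-congˡ (Eq.sym (^-homo-* x p t)))
                   (*-congˡ (Eq.trans (*-congˡ (^-congˡ p y≈))
                     (Eq.trans (*-comm _ _) (Eq.sym (^-homo-* y p t))))))
      (*-cancelʳ-1≤ 1≤y (≤-by (+-mono-≤ upper lower)
        (solve 8 (λ P T y δ a b e f →
             (P :+ T) :* (a :* f) :* y
               :+ (P :* a :* (y :* b :+ T :* (f :* δ)) :+ T :* f :* (e :* y))
          := (P :* (a :* b) :+ T :* (f :* e)) :* y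
               :+ (P :* a :* (y :* f) :+ T :* f :* (a :* y :+ P :* (a :* δ))))
          Eq.refl (fromℕ p) (fromℕ t) y δ (x ^ p) (x ^ t) ((x + δ) ^ p) (y ^ t))))
    where
    δ : Carrier
    δ = y - x
    0≤δ : 0# ≤ δ
    0≤δ = x≤y⇒0≤y-x x≤y
    y≈ : x + δ ≈ y
    y≈ = x+[y-x]≈y x y
    upper : fromℕ p * x ^ p * (y * y ^ t) ≤
            fromℕ p * x ^ p * (y * x ^ t + fromℕ t * (y ^ t * δ))
    upper = *-monoˡ-≤ (*-nonneg (0≤fromℕ p) (^-nonneg p 0≤x))
      (≤-resp (*-cong y≈ (^-congˡ t y≈))
              (+-cong (*-congʳ y≈) (*-congˡ (*-congʳ (^-congˡ t y≈))))
              (^-secant-upper t 0≤x 0≤δ))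
    lower : fromℕ t * y ^ t * (x ^ p * y + fromℕ p * (x ^ p * δ)) ≤
            fromℕ t * y ^ t * ((x + δ) ^ p * y)
    lower = *-monoˡ-≤ (*-nonneg (0≤fromℕ t) (^-nonneg t (1≤⇒0≤ 1≤y)))
      (≤-resp (+-congʳ (*-congˡ y≈)) (*-congˡ y≈) (^-secant-lower p 0≤x 0≤δ))

  ^-secant : ∀ {x δ} m → 0# ≤ x → 0# ≤ δ → 1# ≤ x + δ →
    (x + δ) ^ m ≤ x ^ m + fromℕ m * (x + δ) ^ m * δ
  ^-secant {x} {δ} m 0≤x 0≤δ 1≤y = *-cancelʳ-1≤ 1≤y (≤-by
    (+-mono-≤ (^-secant-upper m 0≤x 0≤δ)
      (*-monoˡ-≤ (*-nonneg (*-nonneg (0≤fromℕ m) (^-nonneg m (1≤⇒0≤ 1≤y))) 0≤δ) 1≤y))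
    (solve 5 (λ y δ a b M →
        b :* y :+ (y :* a :+ M :* (b :* δ) :+ M :* b :* δ :* y)
      := (a :+ M :* b :* δ) :* y :+ (y :* b :+ M :* b :* δ :* con 1))
      Eq.refl (x + δ) δ (x ^ m) ((x + δ) ^ m) (fromℕ m)))

  -- Existence of roots

  module _ (a : Carrier) (1≤a : 1# ≤ a) (m : ℕ) where

    private
      q : ℕ
      q = suc m

      BelowRoot : Carrier → Set
      BelowRoot x = 0# ≤ x × x ^ q ≤ a

      below-1 : BelowRoot 1#
      below-1 = 0≤1 , ≤-trans (≤-reflexive (1^ q)) 1≤a
        where
        1^ : ∀ k → 1# ^ k ≈ 1#
        1^ zero    = Eq.refl
        1^ (suc k) = Eq.trans (*-identityˡ _) (1^ k)

      below-bound : UpperBound BelowRoot a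
      below-bound x (_ , xᑫ≤a) = ^-cancelˡ-≤ m 1≤a (≤-trans xᑫ≤a
        (≤-resp (*-identityʳ a) Eq.refl (*-monoˡ-≤ (1≤⇒0≤ 1≤a) (1≤^ m 1≤a))))

      sup : ∃ (IsSupremum BelowRoot)
      sup = supremum BelowRoot (1# , below-1) (a , below-bound)

    root : Carrier
    root = proj₁ sup

    private
      r-upper : UpperBound BelowRoot root
      r-upper = proj₁ (proj₂ sup)

      r-least : ∀ u → UpperBound BelowRoot u → root ≤ u
      r-least = proj₂ (proj₂ sup)

    1≤root : 1# ≤ root
    1≤root = r-upper 1# below-1

    private
      0≤r : 0# ≤ root
      0≤r = 1≤⇒0≤ 1≤root

      quotient : ∀ {x D} → 1# ≤ D → D * (x * D ⁻¹) ≈ x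
      quotient {x} {D} 1≤D = Eq.trans
        (solve 3 (λ x D I → D :* (x :* I) := x :* (D :* I)) Eq.refl x D (D ⁻¹))
        (Eq.trans (*-congˡ (⁻¹-inverseʳ (1≤⇒≉0 1≤D))) (*-identityʳ x))

      -- Each x in the set has root ^ q ≤ x ^ q + D (root - x) ≤ a + D (root - x), that is, x ≤ root
      -- - δ. So root - δ is an upper bound too, which forces δ ≤ 0.
      root^≤a : root ^ q ≤ a
      root^≤a = ≤-by
        (+-mono-≤ (*-monoʳ-≤ (1≤⇒0≤ 1≤D) r+δ≤r) (≤-reflexive (Eq.sym a+Dδ≈rᑫ)))
        (solve 5 (λ r δ D a b →
            b :+ (r :* D :+ (a :+ D :* δ)) := a :+ ((r :+ δ) :* D :+ b))
          Eq.refl root δ D a (root ^ q))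
        where
        D : Carrier
        D = fromℕ q * root ^ q
        1≤D : 1# ≤ D
        1≤D = 1≤* (1≤fromℕ {q} (s≤s z≤n)) (1≤^ q 1≤root)
        δ : Carrier
        δ = (root ^ q - a) * D ⁻¹
        a+Dδ≈rᑫ : a + D * δ ≈ root ^ q
        a+Dδ≈rᑫ = Eq.trans (+-congˡ (quotient 1≤D)) (x+[y-x]≈y a (root ^ q))
        bound : ∀ x → BelowRoot x → x + δ ≤ root
        bound x (0≤x , xᑫ≤a) = *-cancelʳ-1≤ 1≤D
          (≤-resp Eq.refl (*-congʳ x+ε≈r) (≤-by
            (+-mono-≤ (+-mono-≤ secant xᑫ≤a) (≤-reflexive a+Dδ≈rᑫ))
            (solve 7 (λ x δ ε D a b c →
                (x :+ δ) :* D :+ (b :+ D :* ε :+ a :+ c)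
              := (x :+ ε) :* D :+ (c :+ b :+ (a :+ D :* δ)))
              Eq.refl x δ ε D a (x ^ q) (root ^ q))))
          where
          ε : Carrier
          ε = root - x
          x+ε≈r : x + ε ≈ root
          x+ε≈r = x+[y-x]≈y x root
          secant : root ^ q ≤ x ^ q + D * ε
          secant = ≤-resp (^-congˡ q x+ε≈r)
            (+-congˡ (*-congʳ (*-congˡ (^-congˡ q x+ε≈r))))
            (^-secant q 0≤x (x≤y⇒0≤y-x (r-upper x (0≤x , xᑫ≤a)))
              (≤-resp Eq.refl (Eq.sym x+ε≈r) 1≤root))
        r+δ≤r : root + δ ≤ root
        r+δ≤r = ≤-addʳ (r-least (root - δ) λ x below → ≤-subʳ (bound x below))

      -- Otherwise a step δ to the right stays in the set: D ≥ 1 gives δ ≤ a, so D bounds the slope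
      -- up to root + δ, and (root + δ) ^ q ≤ root ^ q + D δ = a. Hence δ ≤ 0.
      a≤root^ : a ≤ root ^ q
      a≤root^ with ≤-total a (root ^ q)
      ... | inj₁ a≤rᑫ = a≤rᑫ
      ... | inj₂ rᑫ≤a = ≤-by
        (+-mono-≤ (*-monoʳ-≤ (1≤⇒0≤ 1≤D) (r-upper (root + δ) below))
                  (≤-reflexive (Eq.sym rᑫ+Dδ≈a)))
        (solve 5 (λ r δ D a b →
            a :+ (r :* D :+ (b :+ D :* δ)) := b :+ ((r :+ δ) :* D :+ a))
          Eq.refl root δ D a (root ^ q))
        where
        D : Carrier
        D = fromℕ q * (root + a) ^ q
        1≤r+a : 1# ≤ root + a
        1≤r+a = ≤-trans 1≤root (x≤x+y root (1≤⇒0≤ 1≤a))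
        1≤D : 1# ≤ D
        1≤D = 1≤* (1≤fromℕ {q} (s≤s z≤n)) (1≤^ q 1≤r+a)
        δ : Carrier
        δ = (a - root ^ q) * D ⁻¹
        rᑫ+Dδ≈a : root ^ q + D * δ ≈ a
        rᑫ+Dδ≈a = Eq.trans (+-congˡ (quotient 1≤D)) (x+[y-x]≈y (root ^ q) a)
        0≤δ : 0# ≤ δ
        0≤δ = *-nonneg (x≤y⇒0≤y-x rᑫ≤a) (0≤⁻¹ (1≤⇒0≤ 1≤D) (1≤⇒≉0 1≤D))
        δ≤a : δ ≤ a
        δ≤a = ≤-by
          (+-mono-≤ (*-monoʳ-≤ 0≤δ 1≤D)
            (+-mono-≤ (≤-reflexive rᑫ+Dδ≈a) (^-nonneg q 0≤r)))
          (solve 4 (λ δ D a b →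
              δ :+ (D :* δ :+ (a :+ b)) := a :+ (con 1 :* δ :+ (b :+ D :* δ :+ con 0)))
            Eq.refl δ D a (root ^ q))
        below : BelowRoot (root + δ)
        below = +-nonneg 0≤r 0≤δ , ≤-trans
          (^-secant q 0≤r 0≤δ (≤-trans 1≤root (x≤x+y root 0≤δ)))
          (≤-trans
            (+-monoʳ-≤ (root ^ q) (*-monoʳ-≤ 0≤δ (*-monoˡ-≤ (0≤fromℕ q)
              (^-monoˡ-≤ q (+-nonneg 0≤r 0≤δ) (+-monoʳ-≤ root δ≤a)))))
            (≤-reflexive rᑫ+Dδ≈a))

    root^≈ : root ^ q ≈ a
    root^≈ = ≤-antisym root^≤a a≤root^

-- Rational powers of integers

module Weights (ℝ : CompleteOrderedField) where
  open CompleteOrderedField ℝ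
  open OrderProperties ℝ
  open OrderedFieldProperties ℝ
  open Powers ℝ
  open ExpProperties semiring using (^-homo-*; ^-congˡ; ^-assocʳ)
  open SemiringMultProperties semiring using (×-homo-+; ×-congˡ)

  module _ (m p : ℕ) where

    private
      -- The index is shifted by one to keep the radicand, and so the root, at least 1.
      ρ : ℕ → Carrier
      ρ k = root (fromℕ (suc k)) (1≤fromℕ {suc k} (s≤s z≤n)) m

      1≤ρ : ∀ k → 1# ≤ ρ k
      1≤ρ k = 1≤root (fromℕ (suc k)) (1≤fromℕ {suc k} (s≤s z≤n)) m

      ρ^≈ : ∀ k → ρ k ^ suc m ≈ fromℕ (suc k)
      ρ^≈ k = root^≈ (fromℕ (suc k)) (1≤fromℕ {suc k} (s≤s z≤n)) m

      ρ-mono : ∀ {j k} → j ℕ.≤ k → ρ j ≤ ρ k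
      ρ-mono {j} {k} j≤k = ^-cancelˡ-≤ m (1≤ρ k)
        (≤-resp (Eq.sym (ρ^≈ j)) (Eq.sym (ρ^≈ k)) (fromℕ-mono-≤ (s≤s j≤k)))

    -- weight k = (k + 1) ^ (p / (m + 1)).
    weight : ℕ → Carrier
    weight k = ρ k ^ p

    1≤weight : ∀ k → 1# ≤ weight k
    1≤weight k = 1≤^ p (1≤ρ k)

    weight-mono : ∀ {j k} → j ℕ.≤ k → weight j ≤ weight k
    weight-mono {j} j≤k = ^-monoˡ-≤ p (1≤⇒0≤ (1≤ρ j)) (ρ-mono j≤k)

    -- The equation that `RationalPowerBelow` asks of a rational power of k + 1.
    weight^≈ : ∀ k → weight k ^ suc m ≈ fromℕ (suc k) ^ p
    weight^≈ k = Eq.trans (^-assocʳ (ρ k) p (suc m))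
      (Eq.trans (Eq.reflexive (≡.cong (ρ k ^_) (ℕ.*-comm p (suc m))))
        (Eq.trans (Eq.sym (^-assocʳ (ρ k) (suc m) p)) (^-congˡ p (ρ^≈ k))))

    -- Bernoulli's inequality (1 - 1 / (k + 2)) ^ r ≤ 1 - r / (k + 2) for
    -- r = p / (m + 1), with denominators cleared.
    weight-ratio : ∀ {t} → p ℕ.+ t ≡ suc m → ∀ k →
      fromℕ (suc m) * weight k * fromℕ (suc (suc k)) ≤
      weight (suc k) * (fromℕ (suc m) * fromℕ (suc k) + fromℕ t)
    weight-ratio {t} p+t≡q k =
      ≤-resp (Eq.trans (*-congˡ (*-congʳ q≈))
               (Eq.trans (solve 4 (λ e Q a f → e :* (Q :* (a :* f)) := Q :* a :* (e :* f))
                           Eq.refl _ _ _ _)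
                 (*-congˡ (Eq.trans (Eq.sym (^-homo-* y p t)) y^≈))))
             (*-congˡ (Eq.trans (+-cong (*-congˡ x^≈) (*-congˡ y^≈))
               (Eq.trans (solve 3 (λ P T K → P :* K :+ T :* (con 1 :+ K) := (P :+ T) :* K :+ T)
                           Eq.refl (fromℕ p) (fromℕ t) (fromℕ (suc k)))
                 (+-congʳ (*-congʳ (Eq.trans (Eq.sym (×-homo-+ 1# p t)) q≈))))))
        -- AM-GM is multiplied by y ^ p, which turns y ^ t into k + 2 on the left. On the right, p
        -- (k + 1) + t (k + 2) = (m + 1) (k + 1) + t.
        (*-monoˡ-≤ (1≤⇒0≤ (1≤weight (suc k)))
          (weighted-AM-GM p t (1≤⇒0≤ (1≤ρ k)) (ρ-mono (ℕ.n≤1+n k)) (1≤ρ (suc k))))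
      where
      x y : Carrier
      x = ρ k
      y = ρ (suc k)
      q≈ : fromℕ (p ℕ.+ t) ≈ fromℕ (suc m)
      q≈ = ×-congˡ p+t≡q
      x^≈ : x ^ (p ℕ.+ t) ≈ fromℕ (suc k)
      x^≈ = Eq.trans (Eq.reflexive (≡.cong (x ^_) p+t≡q)) (ρ^≈ k)
      y^≈ : y ^ (p ℕ.+ t) ≈ fromℕ (suc (suc k))
      y^≈ = Eq.trans (Eq.reflexive (≡.cong (y ^_) p+t≡q)) (ρ^≈ (suc k))

-- Total height over a set of cups

module SubsetSums (ℝ : CompleteOrderedField) where
  open CompleteOrderedField ℝ
  open OrderProperties ℝ
  open OrderedFieldProperties ℝ

  sumOver : ∀ {n} → Subset n → Vector Carrier n → Carrier
  sumOver []            h = 0#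
  sumOver (inside ∷ A)  h = h zero + sumOver A (tail h)
  sumOver (outside ∷ A) h = sumOver A (tail h)

  sumOver-+ : ∀ {n} (A : Subset n) h w → sumOver A (λ i → h i + w i) ≈ sumOver A h + sumOver A w
  sumOver-+ []            h w = Eq.sym (+-identityˡ 0#)
  sumOver-+ (inside ∷ A)  h w = Eq.trans (+-congˡ (sumOver-+ A (tail h) (tail w)))
    (solve 4 (λ a b c d → a :+ b :+ (c :+ d) := a :+ c :+ (b :+ d)) Eq.refl _ _ _ _)
  sumOver-+ (outside ∷ A) h w = sumOver-+ A (tail h) (tail w)

  sumOver≤sum : ∀ {n} (A : Subset n) w → (∀ i → 0# ≤ w i) → sumOver A w ≤ sum w
  sumOver≤sum []            w 0≤w = ≤-refl
  sumOver≤sum (inside ∷ A)  w 0≤w = +-monoʳ-≤ (w zero) (sumOver≤sum A (tail w) λ i → 0≤w (suc i))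
  sumOver≤sum (outside ∷ A) w 0≤w = ≤-trans (sumOver≤sum A (tail w) λ i → 0≤w (suc i))
    (≤-trans (x≤x+y (sum (tail w)) (0≤w zero)) (≤-reflexive (+-comm _ (w zero))))

  sumOver-≤ : ∀ {n} (A : Subset n) h {b} → (∀ i → h i ≤ b) → sumOver A h ≤ fromℕ ∣ A ∣ * b
  sumOver-≤ []            h h≤b = ≤-reflexive (Eq.sym (zeroˡ _))
  sumOver-≤ (inside ∷ A)  h {b} h≤b = ≤-trans
    (+-mono-≤ (h≤b zero) (sumOver-≤ A (tail h) λ i → h≤b (suc i)))
    (≤-reflexive (solve 2 (λ b K → b :+ K :* b := (con 1 :+ K) :* b) Eq.refl b (fromℕ ∣ A ∣)))
  sumOver-≤ (outside ∷ A) h h≤b = sumOver-≤ A (tail h) λ i → h≤b (suc i)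

  sumOver-⊥ : ∀ {n} (h : Vector Carrier n) → sumOver ⊥ h ≈ 0#
  sumOver-⊥ {zero}  h = Eq.refl
  sumOver-⊥ {suc n} h = sumOver-⊥ (tail h)

  ∣insert∣ : ∀ {n} (A : Subset n) i → lookup A i ≡ outside → ∣ A [ i ]≔ inside ∣ ≡ suc ∣ A ∣
  ∣insert∣ (outside ∷ A) zero    _   = ≡.refl
  ∣insert∣ (inside ∷ A)  (suc i) i∉A = ≡.cong suc (∣insert∣ A i i∉A)
  ∣insert∣ (outside ∷ A) (suc i) i∉A = ∣insert∣ A i i∉A

  sumOver-insert : ∀ {n} (A : Subset n) i h → lookup A i ≡ outside →
    sumOver (A [ i ]≔ inside) h ≈ sumOver A h + h i
  sumOver-insert (outside ∷ A) zero    h _   = +-comm _ _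
  sumOver-insert (inside ∷ A)  (suc i) h i∉A =
    Eq.trans (+-congˡ (sumOver-insert A i (tail h) i∉A)) (Eq.sym (+-assoc _ _ _))
  sumOver-insert (outside ∷ A) (suc i) h i∉A = sumOver-insert A i (tail h) i∉A

  sumOver-singleton : ∀ {n} i (h : Vector Carrier n) → sumOver (⊥ [ i ]≔ inside) h ≈ h i
  sumOver-singleton i h = Eq.trans (sumOver-insert ⊥ i h (lookup-replicate i outside))
    (Eq.trans (+-congʳ (sumOver-⊥ h)) (+-identityˡ (h i)))

  sumOver-updateAt-outside : ∀ {n} (A : Subset n) i h f → lookup A i ≡ outside →
    sumOver A (updateAt h i f) ≈ sumOver A h
  sumOver-updateAt-outside (outside ∷ A) zero    h f _   = Eq.refl
  sumOver-updateAt-outside (inside ∷ A)  (suc i) h f i∉A =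
    +-congˡ (sumOver-updateAt-outside A i (tail h) f i∉A)
  sumOver-updateAt-outside (outside ∷ A) (suc i) h f i∉A =
    sumOver-updateAt-outside A i (tail h) f i∉A

  sumOver-updateAt-inside : ∀ {n} (A : Subset n) i h f → lookup A i ≡ inside →
    sumOver A (updateAt h i f) + h i ≈ sumOver A h + f (h i)
  sumOver-updateAt-inside (inside ∷ A)  zero    h f _   =
    solve 3 (λ a b c → a :+ b :+ c := c :+ b :+ a) Eq.refl _ _ _
  sumOver-updateAt-inside (inside ∷ A)  (suc i) h f i∈A = Eq.trans (+-assoc _ _ _)
    (Eq.trans (+-congˡ (sumOver-updateAt-inside A i (tail h) f i∈A)) (Eq.sym (+-assoc _ _ _)))
  sumOver-updateAt-inside (outside ∷ A) (suc i) h f i∈A =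
    sumOver-updateAt-inside A i (tail h) f i∈A

-- The inequality behind the induction on set size

module Potential (ℝ : CompleteOrderedField) where
  open CompleteOrderedField ℝ
  open OrderProperties ℝ
  open OrderedFieldProperties ℝ

  -- The emptied cup, of height G, lies outside a set of k cups with total X;
  -- with that cup added, the total before the move was X′.  Here c = 1 + d, and
  -- the step from slack s to 1 + s pays for P / q being below d / (1 + d) by up
  -- to 1 / q.
  potential-step : ∀ {d N W k P t q s v v′ X X′ G} →
    0# ≤ d → 0# ≤ N → 0# ≤ W → 1# ≤ k → 0# ≤ t → 1# ≤ q → 0# ≤ s → 1# ≤ v → 1# ≤ v′ →
    P + t ≈ q → q * d ≤ (1# + d) * (1# + P) → s ≤ q →
    q * v * (1# + k) ≤ v′ * (q * k + t) →
    X ≤ k * ((1# + d) * G) →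
    X + G ≤ X′ + 1# →
    v′ * (N * (d * X′ + (1# + k) * (1# + d))) ≤ W * (1# + k) * s →
    v * (N * (d * X + k * (1# + d))) ≤ W * k * (1# + s)
  potential-step {d} {N} {W} {k} {P} {t} {q} {s} {v} {v′} {X} {X′} {G}
    0≤d 0≤N 0≤W 1≤k 0≤t 1≤q 0≤s 1≤v 1≤v′ P+t≈q qd≤ s≤q ratio X≤ X+G≤ IH = goal
    where
    c κ Y : Carrier
    c = 1# + d
    κ = k * c
    Y = N * (d * X + κ)
    0≤k : 0# ≤ k
    0≤k = 1≤⇒0≤ 1≤k
    0≤q : 0# ≤ q
    0≤q = 1≤⇒0≤ 1≤q
    1≤c : 1# ≤ c
    1≤c = x≤x+y 1# 0≤d
    1≤κ : 1# ≤ κ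
    1≤κ = 1≤* 1≤k 1≤c
    0≤κ : 0# ≤ κ
    0≤κ = 1≤⇒0≤ 1≤κ

    -- X ≤ κ G gives (1 + κ) X ≤ κ (X + G) ≤ κ (X′ + 1). The shift by κ absorbs the poured unit
    -- exactly, as d + 1 + k c = (1 + k) c.
    average : (1# + κ) * (d * X + κ) ≤ κ * (d * X′ + (1# + k) * c)
    average = ≤-by
      (+-mono-≤ (*-monoˡ-≤ (*-nonneg 0≤d 0≤κ) X+G≤) (*-monoˡ-≤ 0≤d X≤))
      (solve 5 (λ d k X X′ G →
          let c = con 1 :+ d
              κ = k :* c in
          (con 1 :+ κ) :* (d :* X :+ κ) :+ (d :* κ :* (X′ :+ con 1) :+ d :* (k :* (c :* G)))
        := κ :* (d :* X′ :+ (con 1 :+ k) :* c) :+ (d :* κ :* (X :+ G) :+ d :* X))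
        Eq.refl d k X X′ G)

    weighted : v′ * ((1# + κ) * Y) ≤ κ * (W * (1# + k) * s)
    weighted = ≤-trans
      (≤-resp
        (solve 6 (λ v′ N d X κ k → v′ :* N :* ((con 1 :+ κ) :* (d :* X :+ κ))
                   := v′ :* ((con 1 :+ κ) :* (N :* (d :* X :+ κ)))) Eq.refl v′ N d X κ k)
        (solve 4 (λ v′ N κ Z → v′ :* N :* (κ :* Z) := κ :* (v′ :* (N :* Z)))
          Eq.refl v′ N κ (d * X′ + (1# + k) * c))
        (*-monoˡ-≤ (*-nonneg (1≤⇒0≤ 1≤v′) 0≤N) average))
      (*-monoˡ-≤ 0≤κ IH)

    -- The choice of P gives t c ≤ q + c, so the left side exceeds q (1 + κ) s by at most c s, and c
    -- s ≤ c q ≤ q κ.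
    slack : (q * k + t) * c * s ≤ q * (1# + κ) * (1# + s)
    slack = ≤-by
      (+-mono-≤ (+-mono-≤ (*-monoʳ-≤ (*-nonneg (1≤⇒0≤ 1≤c) 0≤s) (≤-reflexive P+t≈q))
                          (*-monoʳ-≤ 0≤s qd≤))
        (+-mono-≤ (+-mono-≤ (*-monoˡ-≤ (1≤⇒0≤ 1≤c) s≤q)
                            (*-monoˡ-≤ (*-nonneg 0≤q (1≤⇒0≤ 1≤c)) 1≤k)) 0≤q))
      (solve 6 (λ q k P t d s →
          let c = con 1 :+ d in
          (q :* k :+ t) :* c :* s
            :+ (q :* (c :* s) :+ c :* (con 1 :+ P) :* s :+ (c :* q :+ q :* c :* k :+ q))
        := q :* (con 1 :+ k :* c) :* (con 1 :+ s)
            :+ ((P :+ t) :* (c :* s) :+ q :* d :* s :+ (c :* s :+ q :* c :* con 1 :+ con 0)))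
        Eq.refl q k P t d s)

    goal : v * Y ≤ W * k * (1# + s)
    -- `ratio` gets multiplied by (1 + κ) Y, which needs 0 ≤ Y; for Y ≤ 0 the two sides have
    -- opposite signs. In the main case the goal, multiplied by q (1 + k) (1 + κ), follows from
    -- `ratio`, `weighted` and `slack` in turn.
    goal with ≤-total 0# Y
    ... | inj₂ Y≤0 = ≤-trans
      (≤-resp Eq.refl (zeroʳ v) (*-monoˡ-≤ (1≤⇒0≤ 1≤v) Y≤0))
      (*-nonneg (*-nonneg 0≤W 0≤k) (+-nonneg 0≤1 0≤s))
    ... | inj₁ 0≤Y = *-cancelʳ-1≤
      (1≤* (1≤* 1≤q (x≤x+y 1# 0≤k)) (x≤x+y 1# 0≤κ))
      (≤-trans
        (≤-resp
          (solve 5 (λ q v k κ Y → q :* v :* (con 1 :+ k) :* ((con 1 :+ κ) :* Y)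
                     := v :* Y :* (q :* (con 1 :+ k) :* (con 1 :+ κ))) Eq.refl q v k κ Y)
          (solve 3 (λ v′ T Z → v′ :* T :* Z := T :* (v′ :* Z)) Eq.refl _ _ _)
          (*-monoʳ-≤ (*-nonneg (+-nonneg 0≤1 0≤κ) 0≤Y) ratio))
        (≤-trans
          (*-monoˡ-≤ (+-nonneg (*-nonneg 0≤q 0≤k) 0≤t) weighted)
          (≤-resp
            (solve 6 (λ T k c W s K → W :* K :* k :* (T :* c :* s)
                       := T :* (k :* c :* (W :* K :* s))) Eq.refl _ _ _ _ _ _)
            (solve 6 (λ q κ s W k K → W :* K :* k :* (q :* (con 1 :+ κ) :* (con 1 :+ s))
                       := W :* k :* (con 1 :+ s) :* (q :* K :* (con 1 :+ κ)))
              Eq.refl q κ s W k (1# + k))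
            (*-monoˡ-≤ (*-nonneg (*-nonneg 0≤W (+-nonneg 0≤1 0≤k)) 0≤k) slack))))

-- The invariant of the greedy player

module Analysis (ℝ : CompleteOrderedField) (c : CompleteOrderedField.Carrier ℝ)
  (1<c : CompleteOrderedField._<_ ℝ (CompleteOrderedField.1# ℝ) c) (m : ℕ) where
  open CompleteOrderedField ℝ
  open OrderProperties ℝ
  open OrderedFieldProperties ℝ
  open Weights ℝ
  open SubsetSums ℝ
  open Potential ℝ
  open RealPower ℝ
  open SemiringMultProperties semiring using (×-homo-+; ×-congˡ)
  open MaxOpProperties (NaturalMax.maxOperator totalOrder) using (⊔-lub)

  n q : ℕ
  n = suc m
  q = n ℕ.+ n

  open CupGame ℝ c n

  d e N Q : Carrier
  d = c - 1#
  e = (c - 1#) * c ⁻¹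
  N = fromℕ n
  Q = fromℕ q

  private
    1≤c : 1# ≤ c
    1≤c = proj₁ 1<c

    0≤d : 0# ≤ d
    0≤d = x≤y⇒0≤y-x 1≤c

    1+d≈c : 1# + d ≈ c
    1+d≈c = x+[y-x]≈y 1# c

    d≉0 : ¬ d ≈ 0#
    d≉0 d≈0 = proj₂ 1<c
      (Eq.trans (Eq.sym (+-identityʳ 1#)) (Eq.trans (+-congˡ (Eq.sym d≈0)) 1+d≈c))

    1≤1+d : 1# ≤ 1# + d
    1≤1+d = x≤x+y 1# 0≤d

    0≤1+d : 0# ≤ 1# + d
    0≤1+d = 1≤⇒0≤ 1≤1+d

    ec≈d : e * c ≈ d
    ec≈d = Eq.trans (*-assoc d (c ⁻¹) c) (Eq.trans
      (*-congˡ (Eq.trans (*-comm (c ⁻¹) c) (⁻¹-inverseʳ (1≤⇒≉0 1≤c)))) (*-identityʳ d))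

    exponent-floor : ∃ λ p → fromℕ p ≤ Q * e × Q * e ≤ fromℕ (suc p)
    exponent-floor = floor (Q * e) (*-nonneg (0≤fromℕ q) (0≤exponent 1<c))

  p : ℕ
  p = proj₁ exponent-floor

  private
    p≤qe : fromℕ p ≤ Q * e
    p≤qe = proj₁ (proj₂ exponent-floor)

    p≤q : p ℕ.≤ q
    p≤q = fromℕ-cancel-≤ (*-cancelʳ-1≤ 1≤c (≤-trans (*-monoʳ-≤ (1≤⇒0≤ 1≤c) p≤qe)
      (≤-trans (≤-reflexive (Eq.trans (*-assoc Q e c) (*-congˡ ec≈d)))
        (*-monoˡ-≤ (0≤fromℕ q) (≤-by 0≤1
          (Eq.trans (+-comm d 1#) (Eq.trans 1+d≈c (Eq.sym (+-identityʳ c)))))))))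

    qd≤ : Q * d ≤ (1# + d) * fromℕ (suc p)
    qd≤ = ≤-resp (Eq.trans (*-assoc Q e c) (*-congˡ ec≈d))
      (Eq.trans (*-comm _ c) (*-congʳ (Eq.sym 1+d≈c)))
      (*-monoʳ-≤ (1≤⇒0≤ 1≤c) (proj₂ (proj₂ exponent-floor)))

    t : ℕ
    t = q ℕ.∸ p

    p+t≡q : p ℕ.+ t ≡ q
    p+t≡q = ℕ.m+[n∸m]≡n p≤q

    -- The denominator suc (m + n) is q, so `w k` is (k + 1) ^ (p / q).
    w : ℕ → Carrier
    w = weight (m ℕ.+ n) p

    1≤w : ∀ k → 1# ≤ w k
    1≤w = 1≤weight (m ℕ.+ n) p

    -- The scale at which heights up to c satisfy the invariant for every set size; see
    -- `low⇒invariant`.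
    W : Carrier
    W = (1# + d) * (1# + d) * w m

    0≤W : 0# ≤ W
    0≤W = *-nonneg (*-nonneg 0≤1+d 0≤1+d) (1≤⇒0≤ (1≤w m))

    0≤N : 0# ≤ N
    0≤N = 0≤fromℕ n

    -- Between n and 2 n for every set of k + 1 ≤ n cups: the lower bound starts the invariant, the
    -- upper one enters the final constant.
    slack : ℕ → Carrier
    slack k = fromℕ (q ℕ.∸ suc k)

  -- Y_{k+1} ≤ (k + 1) b_{k+1}, multiplied by (c - 1) n (k + 1) ^ (p / q).
  Invariant : Heights → Set
  Invariant h = ∀ (A : Subset n) k → ∣ A ∣ ≡ suc k →
    w k * (N * (d * sumOver A h + fromℕ (suc k) * (1# + d))) ≤ W * fromℕ (suc k) * slack k

  potential-mono : ∀ {X X′} k → X ≤ X′ →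
    w k * (N * (d * X + fromℕ (suc k) * (1# + d))) ≤ w k * (N * (d * X′ + fromℕ (suc k) * (1# + d)))
  potential-mono k X≤X′ = *-monoˡ-≤ (1≤⇒0≤ (1≤w k)) (*-monoˡ-≤ 0≤N
    (+-mono-≤ (*-monoˡ-≤ 0≤d X≤X′) ≤-refl))

  -- With K = k + 1 cups of height at most c, the shifted total is at most d K c + K c = K c². The
  -- rest is `w k` ≤ `w m` and n ≤ 2 n - K.
  low⇒invariant : ∀ {h} → (∀ i → h i ≤ 1# + d) → Invariant h
  low⇒invariant {h} low A k ∣A∣≡1+k = ≤-trans
    (potential-mono k (≤-trans (sumOver-≤ A h low) (≤-reflexive (*-congʳ (×-congˡ ∣A∣≡1+k)))))
    (≤-trans
      (*-mono-≤ (*-nonneg 0≤N 0≤d[K[1+d]]+K[1+d]) (1≤⇒0≤ (1≤w m))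
        (weight-mono (m ℕ.+ n) p k≤m) (*-monoʳ-≤ 0≤d[K[1+d]]+K[1+d] N≤slack))
      (≤-reflexive (solve 4 (λ w S d K →
          let c = con 1 :+ d in
          w :* (S :* (d :* (K :* c) :+ K :* c)) := c :* c :* w :* K :* S)
        Eq.refl (w m) (slack k) d K)))
    where
    K : Carrier
    K = fromℕ (suc k)
    0≤d[K[1+d]]+K[1+d] : 0# ≤ d * (K * (1# + d)) + K * (1# + d)
    0≤d[K[1+d]]+K[1+d] = +-nonneg (*-nonneg 0≤d 0≤Kc) 0≤Kc
      where
      0≤Kc : 0# ≤ K * (1# + d)
      0≤Kc = *-nonneg (0≤fromℕ (suc k)) 0≤1+d
    1+k≤n : suc k ℕ.≤ n
    1+k≤n = ≡.subst (ℕ._≤ n) ∣A∣≡1+k (∣p∣≤n A)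
    k≤m : k ℕ.≤ m
    k≤m = ℕ.≤-pred 1+k≤n
    N≤slack : N ≤ slack k
    N≤slack = fromℕ-mono-≤ (ℕ.≤-trans (ℕ.≤-reflexive (≡.sym (ℕ.m+n∸n≡m n n)))
      (ℕ.∸-monoʳ-≤ q 1+k≤n))

  start-invariant : Invariant (λ _ → 0#)
  start-invariant = low⇒invariant λ _ → 0≤1+d

  -- Preservation under one move

  module _ {h : Heights} (inv : Invariant h) (move : Move h) (i : Fin n)
           (greedy : ∀ j → estimate move j ≤ estimate move i) where

    private
      g h′ : Heights
      g  = filled move
      h′ = remove i g

      g≤cgᵢ : ∀ j → g j ≤ (1# + d) * g i
      g≤cgᵢ j = ≤-trans (estimate-lower move j) (≤-trans (greedy j)
        (≤-trans (estimate-upper move i) (≤-reflexive (*-congʳ (Eq.sym 1+d≈c)))))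

      sumOver-g : ∀ A → sumOver A g ≤ sumOver A h + 1#
      sumOver-g A = ≤-trans (≤-reflexive (sumOver-+ A h (pour move)))
        (+-monoʳ-≤ (sumOver A h) (≤-trans (sumOver≤sum A (pour move) (pour-nonneg move))
          (≤-reflexive (pour-total move))))

      x-1≤x : ∀ x → x - 1# ≤ x
      x-1≤x x = ≤-by 0≤1 (Eq.trans (+-comm (x - 1#) 1#)
        (Eq.trans (x+[y-x]≈y 1# x) (Eq.sym (+-identityʳ x))))

      low-step : g i ≤ 1# → Invariant h′
      low-step gᵢ≤1 = low⇒invariant bound
        where
        g≤c : ∀ j → g j ≤ 1# + d
        g≤c j = ≤-trans (g≤cgᵢ j)
          (≤-resp Eq.refl (*-identityʳ (1# + d)) (*-monoˡ-≤ 0≤1+d gᵢ≤1))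
        bound : ∀ j → h′ j ≤ 1# + d
        bound j with j ≟ i
        ... | yes ≡.refl = ≤-trans (≤-reflexive (Eq.reflexive (updateAt-updates i g)))
          (⊔-lub (≤-trans (x-1≤x (g i)) (g≤c i)) 0≤1+d)
        ... | no j≢i = ≤-trans (≤-reflexive (Eq.reflexive (updateAt-minimal j i g j≢i))) (g≤c j)

      -- Cup i holds at least one unit, so a full unit leaves A, and at most one was poured into it.
      inside-step : 1# ≤ g i → ∀ A → lookup A i ≡ inside → sumOver A h′ ≤ sumOver A h
      inside-step 1≤gᵢ A i∈A = ≤-by
        (+-mono-≤ (+-mono-≤ (sumOver-g A) (≤-reflexive (sumOver-updateAt-inside A i g _ i∈A)))
                  (+-mono-≤ emptied (≤-reflexive (x+[y-x]≈y 1# (g i)))))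
        (solve 6 (λ a b x g y z →
            a :+ (x :+ con 1 :+ (b :+ y) :+ (z :+ g)) := x :+ (b :+ (a :+ g) :+ (y :+ (con 1 :+ z))))
          Eq.refl (sumOver A h′) (sumOver A g) (sumOver A h) (g i) ((g i - 1#) ⊔ 0#) (g i - 1#))
        where
        emptied : (g i - 1#) ⊔ 0# ≤ g i - 1#
        emptied = ⊔-lub ≤-refl (x≤y⇒0≤y-x 1≤gᵢ)

      -- The one case that appeals to a larger set: `inv` is applied to A together with i. A set of
      -- all n cups contains i, so the sizes never exceed n.
      outside-step : ∀ A k → ∣ A ∣ ≡ suc k → lookup A i ≡ outside →
        w k * (N * (d * sumOver A h′ + fromℕ (suc k) * (1# + d))) ≤ W * fromℕ (suc k) * slack k
      outside-step A k ∣A∣≡1+k i∉A = ≤-trans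
        (potential-mono k (≤-reflexive (sumOver-updateAt-outside A i g _ i∉A)))
        (≤-trans
          (potential-step 0≤d 0≤N 0≤W (1≤fromℕ {suc k} (s≤s z≤n)) (0≤fromℕ t)
            (1≤fromℕ {q} (s≤s z≤n)) (0≤fromℕ (q ℕ.∸ suc (suc k))) (1≤w k) (1≤w (suc k))
            (Eq.trans (Eq.sym (×-homo-+ 1# p t)) (×-congˡ p+t≡q)) qd≤
            (fromℕ-mono-≤ (ℕ.m∸n≤m q (suc (suc k))))
            (weight-ratio (m ℕ.+ n) p p+t≡q k)
            (≤-trans (sumOver-≤ A g g≤cgᵢ) (≤-reflexive (*-congʳ (×-congˡ ∣A∣≡1+k))))
            (≤-trans (≤-reflexive (Eq.sym (sumOver-insert A i g i∉A))) (sumOver-g A+i))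
            (inv A+i (suc k) ∣A+i∣≡2+k))
          (≤-reflexive (*-congˡ (×-congˡ slack-suc))))
        where
        A+i : Subset n
        A+i = A [ i ]≔ inside
        ∣A+i∣≡2+k : ∣ A+i ∣ ≡ suc (suc k)
        ∣A+i∣≡2+k = ≡.trans (∣insert∣ A i i∉A) (≡.cong suc ∣A∣≡1+k)
        -- Truncated subtraction is exact here: `A+i` is a set of cups, so k + 2 ≤ n ≤ q.
        slack-suc : suc (q ℕ.∸ suc (suc k)) ≡ q ℕ.∸ suc k
        slack-suc = ≡.sym (ℕ.+-∸-assoc 1 {q} {suc (suc k)}
          (ℕ.≤-trans (≡.subst (ℕ._≤ n) ∣A+i∣≡2+k (∣p∣≤n A+i)) (ℕ.m≤m+n n n)))

    remove-invariant : Invariant (remove i (filled move))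
    remove-invariant A k ∣A∣≡1+k with ≤-total (g i) 1#
    ... | inj₁ gᵢ≤1 = low-step gᵢ≤1 A k ∣A∣≡1+k
    ... | inj₂ 1≤gᵢ with lookup A i in eq
    ...   | inside  = ≤-trans (potential-mono k (inside-step 1≤gᵢ A eq)) (inv A k ∣A∣≡1+k)
    ...   | outside = outside-step A k ∣A∣≡1+k eq

  -- From the invariant to the backlog

  private
    nᵉ : Carrier
    nᵉ = power N e (1≤fromℕ {n} (s≤s z≤n)) (0≤exponent 1<c)

    -- Because p / q was rounded down, n ^ (p / q) is among the powers whose supremum is `nᵉ`.
    w≤nᵉ : w m ≤ nᵉ
    w≤nᵉ = proj₁ (proj₂ (supremum _ _ _)) (w m)
      (p , q , _ , p≤qe , 1≤⇒0≤ (1≤w m) , weight^≈ (m ℕ.+ n) p m)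

  -- The 2 comes from slack at most 2 n against the factor n, the square from `W`, and the division
  -- from the factor d on the total.
  constant : Carrier
  constant = fromℕ 2 * ((1# + d) * (1# + d)) * d ⁻¹

  private
    0≤constant : 0# ≤ constant
    0≤constant = *-nonneg (*-nonneg (0≤fromℕ 2) (*-nonneg 0≤1+d 0≤1+d)) (0≤⁻¹ 0≤d d≉0)

  -- The invariant for the singleton of i gives d h_i + c ≤ 2 W. As c = 1 + d, this leaves room for
  -- one more unit in cup i, which covers the intermediate moment.
  invariant⇒height-≤ : ∀ {h} → Invariant h → ∀ i → h i + 1# ≤ constant * nᵉ
  invariant⇒height-≤ {h} inv i = ≤-trans
    (*-cancelʳ-≤ 0≤d d≉0 (≤-trans
      (≤-by (+-mono-≤ Z≤ (+-mono-≤ (*-monoˡ-≤ 0≤d (≤-reflexive (Eq.sym sum≈))) 0≤1))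
        (solve 4 (λ h d S W → (h :+ con 1) :* d :+ (W :+ (d :* S :+ con 1))
            := W :+ (d :* S :+ (con 1 :+ con 0) :* (con 1 :+ d) :+ (d :* h :+ con 0)))
          Eq.refl (h i) d (sumOver A h) (fromℕ 2 * W)))
      (≤-reflexive constant*w*d)))
    (*-monoˡ-≤ 0≤constant w≤nᵉ)
    where
    constant*w*d : fromℕ 2 * W ≈ constant * w m * d
    constant*w*d = Eq.trans (Eq.sym (*-identityʳ _)) (Eq.trans
      (*-congˡ (Eq.sym (⁻¹-inverseʳ d≉0)))
      (solve 5 (λ T c w d I → T :* (c :* c :* w) :* (d :* I) := T :* (c :* c) :* I :* w :* d)
        Eq.refl (fromℕ 2) (1# + d) (w m) d (d ⁻¹)))
    A : Subset n
    A = ⊥ [ i ]≔ inside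
    sum≈ : sumOver A h ≈ h i
    sum≈ = sumOver-singleton i h
    ∣A∣≡1 : ∣ A ∣ ≡ 1
    ∣A∣≡1 = ≡.trans (∣insert∣ ⊥ i (lookup-replicate i outside)) (≡.cong suc (∣⊥∣≡0 n))
    Z : Carrier
    Z = d * sumOver A h + fromℕ 1 * (1# + d)
    Z≤ : Z ≤ fromℕ 2 * W
    -- Replacing `w 0` by 1 in the invariant needs 0 ≤ Z.
    Z≤ with ≤-total 0# Z
    ... | inj₂ Z≤0 = ≤-trans Z≤0 (*-nonneg (0≤fromℕ 2) 0≤W)
    ... | inj₁ 0≤Z = *-cancelʳ-1≤ (1≤fromℕ {n} (s≤s z≤n)) (≤-trans
      (≤-resp (solve 2 (λ Z N → con 1 :* (N :* Z) := Z :* N) Eq.refl Z N) Eq.refl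
        (*-monoʳ-≤ (*-nonneg 0≤N 0≤Z) (1≤w 0)))
      (≤-trans (inv A 0 ∣A∣≡1) (≤-trans
        (*-monoˡ-≤ (*-nonneg 0≤W (0≤fromℕ 1)) (fromℕ-mono-≤ (ℕ.m∸n≤m q 1)))
        (≤-reflexive (Eq.trans (*-congˡ (×-homo-+ 1# n n))
          (solve 2 (λ W N → W :* (con 1 :+ con 0) :* (N :+ N)
                         := (con 1 :+ (con 1 :+ con 0)) :* W :* N) Eq.refl W N))))))

  -- What one cup receives is a sum over a singleton, so at most the whole unit.
  filled≤ : ∀ {h} (move : Move h) i → filled move i ≤ h i + 1#
  filled≤ {h} move i = +-monoʳ-≤ (h i) (≤-trans
    (≤-reflexive (Eq.sym pour≈)) (≤-trans (sumOver≤sum (⊥ [ i ]≔ inside) (pour move)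
      (pour-nonneg move)) (≤-reflexive (pour-total move))))
    where
    pour≈ : sumOver (⊥ [ i ]≔ inside) (pour move) ≈ pour move i
    pour≈ = sumOver-singleton i (pour move)

  module _ (adversary : Adversary) (player : Player) (greedy : Greedy player) where

    run-invariant : ∀ k → Invariant (proj₁ (run adversary player k))
    run-invariant zero    = start-invariant
    run-invariant (suc k) =
      remove-invariant (run-invariant k) (adversary past) _ (greedy past (adversary past))
      where past = proj₂ (run adversary player k)

    visited≤ : ∀ {g} → Visited adversary player g → ∀ i → g i ≤ constant * nᵉ
    visited≤ (between k) i =
      ≤-trans (x≤x+y _ 0≤1) (invariant⇒height-≤ (run-invariant k) i)
    visited≤ (intermediate k) i =
      ≤-trans (filled≤ (adversary (proj₂ (run adversary player k))) i)
              (invariant⇒height-≤ (run-invariant k) i)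

    backlog-≤ : ∃ λ backlog → IsBacklog adversary player backlog × backlog ≤ constant * nᵉ
    backlog-≤ = backlog , isSup , proj₂ isSup (constant * nᵉ) upper
      where
      Peak : Carrier → Set
      Peak x = ∃ λ g → Visited adversary player g × IsFullest g x
      upper : UpperBound Peak (constant * nᵉ)
      upper x (g , visited , (i , gᵢ≈x) , _) = ≤-resp gᵢ≈x Eq.refl (visited≤ visited i)
      sup : ∃ (IsSupremum Peak)
      sup = supremum Peak
        -- All cups are empty at the start, so 0 is an attained maximum and the set is inhabited.
        (0# , _ , between 0 , (zero , Eq.refl) , λ _ → ≤-refl) (constant * nᵉ , upper)
      backlog : Carrier
      backlog = proj₁ sup
      isSup : IsBacklog adversary player backlog
      isSup = proj₂ sup

theorem1 : (ℝ : CompleteOrderedField) →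
    let open CompleteOrderedField ℝ
        open OrderProperties ℝ
        open RealPower ℝ
    in
    (c : Carrier) (1<c : 1# < c) →
    ∃ λ (C : Carrier) →
      (n : ℕ) (1≤n : 1 ℕ.≤ n) →
      let open CupGame ℝ c n in
      (adversary : Adversary) (player : Player) → Greedy player →
      ∃ λ (backlog : Carrier) →
        IsBacklog adversary player backlog ×
        backlog ≤ C * power (fromℕ n) ((c - 1#) * c ⁻¹) (1≤fromℕ 1≤n) (0≤exponent 1<c)
-- This is `constant` written out: C is chosen before n, while `Analysis` depends on n = m + 1.
theorem1 ℝ c 1<c = fromℕ 2 * ((1# + d) * (1# + d)) * d ⁻¹ ,
  λ { (suc m) (s≤s z≤n) → Analysis.backlog-≤ ℝ c 1<c m }
  where
  open CompleteOrderedField ℝ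
  d : Carrier
  d = c - 1#
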